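{- (1) For every positive integer $\alpha$ and every integer $F>3\alpha+3$ with $F\equiv\alpha \pmod 2$, $$T_1(F,\alpha)\geq 2^{\frac{F}{6}-\frac{\alpha}{2}}.$$ (2) For every integer $\alpha\geq 2$ and every real $\epsilon>0$, for all sufficiently large integers $F$, $$T(F,\alpha)>2^{(0.1-\epsilon)F}.$$ Here $T(F,t)$ is the number of numerical semigroups with Frobenius number $F$ and type $t$, and $T_1(F,t)$ is the number of almost symmetric numerical semigroups with Frobenius number $F$ and type $t$.
   Context: $\mathbb{N}=\{0,1,2,\dots\}$. A numerical semigroup is a subset $S\subseteq\mathbb{N}$ containing $0$, closed under addition, with finite complement in $\mathbb{N}$. The elements of $\mathbb{N}\setminus S$ are the gaps of $S$; the genus $g(S)$ is the number of gaps; for $S\neq\mathbb{N}$ the Frobenius number $F(S)$ is the largest gap. The set of pseudo-Frobenius numbers is $PF(S)=\{x\in\mathbb{N}\setminus S \mid x+s\in S \text{ for all } s\in S\setminus\{0\}\}$, and the type is $t(S)=|PF(S)|$. $S$ is almost symmetric if $t(S)=2g(S)-F(S)$. -}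

module Defs where

open import Data.Integer.Base using (+_; -[1+_])
open import Data.List.Base using (List; length)
open import Data.List.Membership.Setoid using () renaming (_∈_ to Member)
open import Data.List.Relation.Unary.All using (All)
open import Data.List.Relation.Unary.Unique.Setoid using (Unique)
open import Data.Nat.Base as ℕ using (ℕ; zero; suc)
import Data.Nat.Properties as ℕ
open import Data.Product using (_×_; _,_; ∃-syntax)
open import Data.Rational.Unnormalised.Base as ℚ
  using (ℚᵘ; mkℚᵘ; 0ℚᵘ; ½; ∣_∣)
import Data.Rational.Unnormalised.Properties as ℚ
open import Data.Rational.Unnormalised.Solver using (module +-*-Solver)
open import Function.Base using (_on_)
open import Level using (0ℓ; _⊔_) renaming (suc to lsuc)
open import Relation.Binary.Bundles using (Setoid)
open import Relation.Binary.PropositionalEquality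
  using (_≡_; _≢_; refl; setoid)
import Relation.Binary.Construct.On as On
open import Relation.Unary using (Pred; Decidable; ∁; _∈_; _∉_)
open import Relation.Unary.Relation.Binary.Equality using (≐-setoid)

------------------------------------------------------------------------
-- Cardinality

-- The elements of A satisfying P, taken up to the equality of A, are
-- exactly n in number.  At most one n has this property.

record HasCard {a ℓ p} (A : Setoid a ℓ) (P : Pred (Setoid.Carrier A) p)
               (n : ℕ) : Set (a ⊔ ℓ ⊔ p) where
  field
    elements : List (Setoid.Carrier A)
    unique   : Unique A elements
    sound    : All P elements
    complete : ∀ {x} → P x → Member A x elements
    size     : length elements ≡ n

∣_∣≔_ : Pred ℕ 0ℓ → ℕ → Set
∣ P ∣≔ n = HasCard (setoid ℕ) P n

------------------------------------------------------------------------
-- Numerical semigroups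

-- Classically a cofinite subset of ℕ is always decidable; constructively
-- this is part of what it means to be given one.

record NumericalSemigroup : Set₁ where
  field
    carrier  : Pred ℕ 0ℓ
    decide   : Decidable carrier
    0∈       : 0 ∈ carrier
    +-closed : ∀ {m n} → m ∈ carrier → n ∈ carrier → m ℕ.+ n ∈ carrier
    cofinite : ∃[ n ] ∣ ∁ carrier ∣≔ n

open NumericalSemigroup public using (carrier)

-- Two numerical semigroups are equal when they have the same elements.

semigroupSetoid : Setoid (lsuc 0ℓ) 0ℓ
semigroupSetoid = On.setoid (≐-setoid ℕ 0ℓ) carrier

Gap : NumericalSemigroup → Pred ℕ 0ℓ
Gap S = ∁ (carrier S)

PF : NumericalSemigroup → Pred ℕ 0ℓ
PF S x = x ∈ Gap S × (∀ {s} → s ∈ carrier S → s ≢ 0 → x ℕ.+ s ∈ carrier S)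

-- Genus, Frobenius number and type are given by their graphs.  For S = ℕ
-- no F satisfies HasFrobenius S F.

HasGenus : NumericalSemigroup → ℕ → Set
HasGenus S g = ∣ Gap S ∣≔ g

HasFrobenius : NumericalSemigroup → ℕ → Set
HasFrobenius S F = F ∈ Gap S × (∀ {x} → x ∈ Gap S → x ℕ.≤ F)

HasType : NumericalSemigroup → ℕ → Set
HasType S t = ∣ PF S ∣≔ t

-- t = 2g − F, with F moved to the left so that subtraction on ℕ is not
-- truncated.

AlmostSymmetric : NumericalSemigroup → Set
AlmostSymmetric S = ∃[ g ] ∃[ F ] ∃[ t ]
  HasGenus S g × HasFrobenius S F × HasType S t × t ℕ.+ F ≡ 2 ℕ.* g

-- T[ F , t ]≔ n  and  T₁[ F , t ]≔ n  say  T(F,t) = n  and  T₁(F,t) = n.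

T[_,_]≔_ : ℕ → ℕ → ℕ → Set₁
T[ F , t ]≔ n =
  HasCard semigroupSetoid (λ S → HasFrobenius S F × HasType S t) n

T₁[_,_]≔_ : ℕ → ℕ → ℕ → Set₁
T₁[ F , t ]≔ n =
  HasCard semigroupSetoid
    (λ S → AlmostSymmetric S × HasFrobenius S F × HasType S t) n

------------------------------------------------------------------------
-- Real numbers, as Cauchy sequences of rationals

record ℝ : Set where
  field
    seq    : ℕ → ℚᵘ
    cauchy : ∀ δ → 0ℚᵘ ℚ.< δ →
             ∃[ N ] (∀ {m n} → N ℕ.≤ m → N ℕ.≤ n → ∣ seq m ℚ.- seq n ∣ ℚ.< δ)

open ℝ public

infix  4 _<ᴿ_
infixl 6 _+ᴿ_ _-ᴿ_
infixl 7 _·ᴿ_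
infix  8 -ᴿ_

_<ᴿ_ : ℝ → ℝ → Set
x <ᴿ y = ∃[ δ ] (0ℚᵘ ℚ.< δ ×
         ∃[ N ] (∀ {n} → N ℕ.≤ n → seq x n ℚ.+ δ ℚ.≤ seq y n))

fromℚ : ℚᵘ → ℝ
fromℚ q = record
  { seq    = λ _ → q
  ; cauchy = λ δ 0<δ → 0 , λ _ _ →
      ℚ.<-respˡ-≃ (ℚ.≃-sym (ℚ.∣-∣-cong (ℚ.+-inverseʳ q))) 0<δ
  }

0ᴿ : ℝ
0ᴿ = fromℚ 0ℚᵘ

-ᴿ_ : ℝ → ℝ
-ᴿ x = record
  { seq    = λ n → ℚ.- seq x n
  ; cauchy = λ δ 0<δ → let (N , close) = cauchy x δ 0<δ in
      N , λ {m} {n} N≤m N≤n →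
        ℚ.<-respˡ-≃ (negate (seq x m) (seq x n)) (close N≤m N≤n)
  }
  where
  negate : ∀ p q → ∣ p ℚ.- q ∣ ℚ.≃ ∣ ℚ.- p ℚ.- ℚ.- q ∣
  negate p q = ℚ.≃-trans (ℚ.≃-sym (ℚ.∣-p∣≃∣p∣ (p ℚ.- q)))
    (ℚ.∣-∣-cong (ℚ.≃-reflexive (ℚ.neg-distrib-+ p (ℚ.- q))))

_+ᴿ_ : ℝ → ℝ → ℝ
x +ᴿ y = record
  { seq    = λ n → seq x n ℚ.+ seq y n
  ; cauchy = λ δ 0<δ →
      let 0<δ/2     = ℚ.positive⁻¹ (½ ℚ.* δ)
                        {{ℚ.pos*pos⇒pos ½ δ {{ℚ.positive 0<δ}}}}
          (M , x-close) = cauchy x (½ ℚ.* δ) 0<δ/2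
          (N , y-close) = cauchy y (½ ℚ.* δ) 0<δ/2
      in M ℕ.⊔ N , λ {m} {n} ≤m ≤n →
        add δ (seq x m) (seq x n) (seq y m) (seq y n)
          (x-close (ℕ.m⊔n≤o⇒m≤o M N ≤m) (ℕ.m⊔n≤o⇒m≤o M N ≤n))
          (y-close (ℕ.m⊔n≤o⇒n≤o M N ≤m) (ℕ.m⊔n≤o⇒n≤o M N ≤n))
  }
  where
  open ℚ.≤-Reasoning
  open +-*-Solver using (solve; _:+_; :-_; _:=_)

  add : ∀ δ p p′ q q′ →
        ∣ p ℚ.- p′ ∣ ℚ.< ½ ℚ.* δ → ∣ q ℚ.- q′ ∣ ℚ.< ½ ℚ.* δ →
        ∣ (p ℚ.+ q) ℚ.- (p′ ℚ.+ q′) ∣ ℚ.< δ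
  add δ p p′ q q′ p-close q-close = begin-strict
    ∣ (p ℚ.+ q) ℚ.- (p′ ℚ.+ q′) ∣
      ≃⟨ ℚ.∣-∣-cong (solve 4 (λ a a′ b b′ →
           (a :+ b) :+ (:- (a′ :+ b′)) := (a :+ (:- a′)) :+ (b :+ (:- b′)))
           ℚ.≃-refl p p′ q q′) ⟩
    ∣ (p ℚ.- p′) ℚ.+ (q ℚ.- q′) ∣   ≤⟨ ℚ.∣p+q∣≤∣p∣+∣q∣ (p ℚ.- p′) (q ℚ.- q′) ⟩
    ∣ p ℚ.- p′ ∣ ℚ.+ ∣ q ℚ.- q′ ∣   <⟨ ℚ.+-mono-< p-close q-close ⟩
    ½ ℚ.* δ ℚ.+ ½ ℚ.* δ             ≃⟨ ℚ.*-distribʳ-+ δ ½ ½ ⟨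
    (½ ℚ.+ ½) ℚ.* δ                 ≃⟨ ℚ.*-congʳ {δ} {½ ℚ.+ ½} {ℚ.1ℚᵘ} (ℚ.*≡* refl) ⟩
    ℚ.1ℚᵘ ℚ.* δ                     ≃⟨ ℚ.*-identityˡ δ ⟩
    δ                               ∎

_-ᴿ_ : ℝ → ℝ → ℝ
x -ᴿ y = x +ᴿ (-ᴿ y)

_·ᴿ_ : ℕ → ℝ → ℝ
zero  ·ᴿ x = 0ᴿ
suc n ·ᴿ x = x +ᴿ (n ·ᴿ x)

------------------------------------------------------------------------
-- Comparison of powers of 2 with natural numbers

-- 2^(a/d) is the positive d-th root of 2^a, so 2^(a/d) ≤ n means 2^a ≤ n^d;
-- for a negative numerator the power of 2 is moved to the right-hand side.

2^ℚ_≤_ : ℚᵘ → ℕ → Set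
2^ℚ mkℚᵘ (+ a)    d-1 ≤ n = 2 ℕ.^ a ℕ.≤ n ℕ.^ suc d-1
2^ℚ mkℚᵘ -[1+ a ] d-1 ≤ n = 1 ℕ.≤ 2 ℕ.^ suc a ℕ.* n ℕ.^ suc d-1

-- For real x, by monotonicity and continuity of the exponential, 2^x < n
-- holds exactly when 2^q ≤ n for some rational q > x.

2^ℝ_<_ : ℝ → ℕ → Set
2^ℝ x < n = ∃[ q ] (x <ᴿ fromℚ q × 2^ℚ q ≤ n)

{-# OPTIONS --safe #-}
module Submission where

open import Data.Bool.Base using (Bool; true; false)
import Data.Bool.Properties as Bool
import Data.Fin.Base as Fin
open import Data.Fin.Properties using (injective⇒≤)
open import Data.Integer.Base as ℤ using (+_; -[1+_])
import Data.Integer.Properties as ℤ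
import Data.Integer.Tactic.RingSolver as ℤSolver
open import Data.List.Base
  using (List; []; _∷_; _++_; [_]; length; map; filter; upTo; applyUpTo;
         lookup; concatMap; deduplicate)
open import Data.List.Properties using (length-map; length-++; length-applyUpTo)
import Data.List.Membership.DecPropositional as DecMembership
open import Data.List.Membership.Propositional
  using () renaming (_∈_ to _∈ₗ_; _∉_ to _∉ₗ_)
import Data.List.Membership.Propositional.Properties as Mem
import Data.List.Membership.Setoid as SetoidMembership
import Data.List.Membership.Setoid.Properties as SetoidMem
open import Data.List.Relation.Unary.All as All using (All; []; _∷_)
import Data.List.Relation.Unary.All.Properties as All
open import Data.List.Relation.Unary.AllPairs as AllPairs using (AllPairs; []; _∷_)
import Data.List.Relation.Unary.AllPairs.Properties as AllPairs
open import Data.List.Relation.Unary.Any as Any using (here; there)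
open import Data.List.Relation.Unary.Unique.Setoid using (Unique)
import Data.List.Relation.Unary.Unique.DecSetoid.Properties as DecUnique
import Data.List.Relation.Unary.Unique.Propositional.Properties as Uniqueₚ
import Data.List.Relation.Unary.Unique.Setoid.Properties as Unique
open import Data.Nat.Base as ℕ hiding (_/_)
open import Data.Nat.DivMod hiding (_/_)
open import Data.Nat.Properties
open import Data.Nat.Tactic.RingSolver using (solve-∀)
open import Data.Product using (_×_; _,_; proj₁; proj₂; ∃-syntax)
open import Data.Rational.Unnormalised.Base as ℚ
  using (mkℚᵘ; 0ℚᵘ; 1ℚᵘ; _/_; _-_)
import Data.Rational.Unnormalised.Properties as ℚ
open import Data.Rational.Unnormalised.Solver using (module +-*-Solver)
open import Data.Sum.Base using (_⊎_; inj₁; inj₂; [_,_]′)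
open import Function.Base using (_∘_; id; _$_)
open import Function.Bundles using (_⇔_; mk⇔; module Equivalence)
open import Level using (Level; 0ℓ)
open import Relation.Binary.Bundles using (Setoid; DecSetoid)
open import Relation.Binary.Definitions using (_Respects_)
open import Relation.Binary.PropositionalEquality hiding ([_])
open import Relation.Nullary using (¬_; Dec; does; yes; no; contradiction)
open import Relation.Nullary.Decidable
  using (map′; decidable-stable; ¬?; _×-dec_; _⊎-dec_)
open import Relation.Unary using (Pred; Decidable; _∈_; _⊆_; _≐_)
open import Defs

-- Fix F = 2h + b + 1 and m with F < 3m and m ≤ h + 1.  For an arbitrary set
-- Y of integers in [m, h], the set of 0, Y and all z ≥ h + b + 1 with
-- F − z ∉ Y ∪ {0} is a numerical semigroup with Frobenius number F: a sum of
-- two nonzero elements is at least 2m, so its complement to F is below m.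
-- Both z and F − z are gaps exactly for the b integers strictly between h and
-- h + b + 1, and these are pseudo-Frobenius, so the semigroup is almost
-- symmetric of type b + 1.  Taking m = ⌊F/3⌋ + 1 leaves about F/6 − α/2 free
-- choices, which is (1).
--
-- This forces F ≡ type (mod 2).  For the other parity write F = m + 2x with
-- x < m, put m in Y and also remove r = m + x.  Then r becomes
-- pseudo-Frobenius while F − r = x does not, because x + m = r; so the type
-- is b + 2, and again about F/6 choices remain.

private
  variable
    ℓ ℓ₀ ℓ₁ ℓ₂ : Level

open DecMembership _≟_ using () renaming (_∈?_ to _∈ₗ?_)

-- Finite cardinalities

module _ (A : Setoid ℓ₀ ℓ) where
  open Setoid A using (Carrier; _≈_)
  private module A = Setoid A
  open SetoidMembership A using () renaming (_∈_ to _∈ₐ_)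

  lookup-injective : ∀ {xs} → Unique A xs → ∀ i j →
                     lookup xs i ≈ lookup xs j → i ≡ j
  lookup-injective (_  ∷ _)   Fin.zero    Fin.zero    _  = refl
  lookup-injective (x∉ ∷ _)   Fin.zero    (Fin.suc j) eq =
    contradiction eq (All.lookup x∉ (Mem.∈-lookup j))
  lookup-injective (x∉ ∷ _)   (Fin.suc i) Fin.zero    eq =
    contradiction (A.sym eq) (All.lookup x∉ (Mem.∈-lookup i))
  lookup-injective (_  ∷ xs!) (Fin.suc i) (Fin.suc j) eq =
    cong Fin.suc (lookup-injective xs! i j eq)

  -- Pigeonhole: sending a position in `xs` to the position of an equal element in `ys` is
  -- injective.
  unique-length-≤ : ∀ {xs ys} → Unique A xs → (∀ {x} → x ∈ₗ xs → x ∈ₐ ys) →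
                    length xs ≤ length ys
  unique-length-≤ xs! xs⊆ys = injective⇒≤ λ {i} {j} eq →
    lookup-injective xs! i j (SetoidMem.index-injective A
      (xs⊆ys (Mem.∈-lookup i)) (xs⊆ys (Mem.∈-lookup j)) eq)

  card-≥ : ∀ {P : Pred Carrier ℓ₁} {n xs} → HasCard A P n →
           Unique A xs → All P xs → length xs ≤ n
  card-≥ c xs! pxs = subst (_ ≤_) size
    (unique-length-≤ xs! (λ x∈xs → complete (All.lookup pxs x∈xs)))
    where open HasCard c

  card-unique : ∀ {P : Pred Carrier ℓ₁} {m n} →
                HasCard A P m → HasCard A P n → m ≡ n
  card-unique c d = ≤-antisym (card≤ c d) (card≤ d c)
    where
    card≤ : ∀ {m n} → HasCard A _ m → HasCard A _ n → m ≤ n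
    card≤ c d = subst (_≤ _) size (card-≥ d unique sound)
      where open HasCard c

  card-cong : ∀ {P : Pred Carrier ℓ₁} {Q : Pred Carrier ℓ₂} {n} →
              P ≐ Q → HasCard A P n → HasCard A Q n
  card-cong (P⊆Q , Q⊆P) c = record
    { elements = elements
    ; unique   = unique
    ; sound    = All.map P⊆Q sound
    ; complete = complete ∘ Q⊆P
    ; size     = size
    } where open HasCard c

module _ (A : DecSetoid ℓ₀ ℓ) where
  open DecSetoid A using (Carrier; _≈_) renaming (_≟_ to _≈?_; setoid to Aₛ)
  private module A = DecSetoid A
  open SetoidMembership Aₛ using () renaming (_∈_ to _∈ₐ_)

  -- Deduplication may keep another representative of a class than the one at hand, so `P` has to
  -- respect `_≈_`.
  finiteCard : ∀ {P : Pred Carrier ℓ₁} → Decidable P → P Respects _≈_ →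
               ∀ xs → (∀ {x} → P x → x ∈ₐ xs) → ∃[ n ] HasCard Aₛ P n
  finiteCard P? resp xs cover = _ , record
    { elements = filter P? (deduplicate _≈?_ xs)
    ; unique   = Unique.filter⁺ Aₛ P? (DecUnique.deduplicate-! A xs)
    ; sound    = All.all-filter P? (deduplicate _≈?_ xs)
    ; complete = λ px → SetoidMem.∈-filter⁺ Aₛ P? resp
        (SetoidMem.∈-deduplicate⁺ Aₛ _≈?_
          (λ c≈b a≈b → A.trans a≈b (A.sym c≈b)) (cover px)) px
    ; size     = refl
    }

ℕ-decSetoid : DecSetoid 0ℓ 0ℓ
ℕ-decSetoid = decSetoid _≟_

finiteCardℕ : ∀ {P : Pred ℕ 0ℓ} → Decidable P → ∀ xs →
              (∀ {x} → P x → x ∈ₗ xs) → ∃[ n ] ∣ P ∣≔ n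
finiteCardℕ P? = finiteCard ℕ-decSetoid P? (λ { refl → id })

-- Decidability of the invariants of a numerical semigroup

module _ (S : NumericalSemigroup) where
  open NumericalSemigroup S using (decide; cofinite)
  open HasCard (proj₂ cofinite)

  gaps : List ℕ
  gaps = elements

  gap⇒∈ : ∀ {x} → x ∈ Gap S → x ∈ₗ gaps
  gap⇒∈ = complete

  ∈⇒gap : ∀ {x} → x ∈ₗ gaps → x ∈ Gap S
  ∈⇒gap = All.lookup sound

  frobenius? : Decidable (HasFrobenius S)
  frobenius? F = ¬? (decide F) ×-dec
    map′ (λ all g → All.lookup all (gap⇒∈ g)) (λ bound → All.tabulate (bound ∘ ∈⇒gap))
         (All.all? (_≤? F) gaps)

  frobenius-unique : ∀ {F F′} → HasFrobenius S F → HasFrobenius S F′ → F ≡ F′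
  frobenius-unique (g , bound) (g′ , bound′) = ≤-antisym (bound′ g) (bound g′)

  -- A failure `x + s ∉ S` is a gap `y > x` with `y ∸ x ∈ S`, so the quantifier over all `s` becomes
  -- a search through the finitely many gaps.
  pf? : Decidable (PF S)
  pf? x = ¬? (decide x) ×-dec map′ to from
    (All.all? (λ y → ¬? (x <? y ×-dec decide (y ∸ x))) gaps)
    where
    to : All (λ y → ¬ (x < y × y ∸ x ∈ carrier S)) gaps →
         ∀ {s} → s ∈ carrier S → s ≢ 0 → x + s ∈ carrier S
    to all {s} s∈S s≢0 = decidable-stable (decide (x + s)) λ x+s∉S →
      All.lookup all (gap⇒∈ x+s∉S)
        ( m<m+n x (n≢0⇒n>0 s≢0)
        , subst (_∈ carrier S) (sym (m+n∸m≡n x s)) s∈S)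

    from : (∀ {s} → s ∈ carrier S → s ≢ 0 → x + s ∈ carrier S) →
           All (λ y → ¬ (x < y × y ∸ x ∈ carrier S)) gaps
    from closed = All.tabulate λ {y} y∈gaps (x<y , y∸x∈S) → ∈⇒gap y∈gaps
      (subst (_∈ carrier S) (m+[n∸m]≡n (<⇒≤ x<y))
        (closed y∸x∈S (m>n⇒m∸n≢0 x<y)))

  type? : Decidable (HasType S)
  type? t = map′ (λ { refl → has }) (card-unique _ has) (t₀ ≟ t)
    where
    t₀ = proj₁ (finiteCardℕ pf? gaps (gap⇒∈ ∘ proj₁))
    has = proj₂ (finiteCardℕ pf? gaps (gap⇒∈ ∘ proj₁))

  -- Genus, Frobenius number and type are unique, so the existential quantifiers in
  -- `AlmostSymmetric` collapse to one equation between numbers.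
  almostSymmetric-frobenius-type? : ∀ F t →
    Dec (AlmostSymmetric S × HasFrobenius S F × HasType S t)
  almostSymmetric-frobenius-type? F t with frobenius? F ×-dec type? t
  ... | no  ¬ft         = no (¬ft ∘ proj₂)
  ... | yes ft@(fr , ty) = map′
    (λ eq → (_ , _ , _ , proj₂ cofinite , fr , ty , eq) , ft)
    (λ ((g , F′ , t′ , g-card , fr′ , ty′ , eq) , _) →
      subst (λ g → t + F ≡ 2 * g) (card-unique _ g-card (proj₂ cofinite))
        (subst₂ (λ t F → t + F ≡ 2 * g) (card-unique _ ty′ ty)
          (frobenius-unique fr′ fr) eq))
    (t + F ≟ 2 * proj₁ cofinite)

open Setoid semigroupSetoid using () renaming (_≈_ to _≈ₛ_; sym to ≈ₛ-sym)

-- Inclusion in `T` means that no gap of `T` lies in `S`, which is a finite test.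
semigroup-≟ : ∀ S T → Dec (S ≈ₛ T)
semigroup-≟ S T = ⊆? S T ×-dec ⊆? T S
  where
  ⊆? : ∀ S T → Dec (carrier S ⊆ carrier T)
  ⊆? S T = map′
    (λ all {x} x∈S → decidable-stable (decide T x) λ x∉T →
      All.lookup all (gap⇒∈ T x∉T) x∈S)
    (λ S⊆T → All.tabulate λ x∈gaps x∈S → ∈⇒gap T x∈gaps (S⊆T x∈S))
    (All.all? (λ x → ¬? (decide S x)) (gaps T))
    where open NumericalSemigroup using (decide)

semigroupDecSetoid : DecSetoid _ _
semigroupDecSetoid = record
  { isDecEquivalence = record
    { isEquivalence = Setoid.isEquivalence semigroupSetoid
    ; _≟_           = semigroup-≟
    }
  }

gap-cong : ∀ {S T} → S ≈ₛ T → Gap S ≐ Gap T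
gap-cong (S⊆T , T⊆S) = (λ x∉S x∈T → x∉S (T⊆S x∈T)) , (λ x∉T x∈S → x∉T (S⊆T x∈S))

pf-⊆ : ∀ {S T} → S ≈ₛ T → PF S ⊆ PF T
pf-⊆ {S} {T} S≈T@(S⊆T , T⊆S) (gap , closed) =
  proj₁ (gap-cong {S} {T} S≈T) gap , λ s∈T s≢0 → S⊆T (closed (T⊆S s∈T) s≢0)

type-resp : ∀ {t} → (λ S → HasType S t) Respects _≈ₛ_
type-resp {_} {S} {T} S≈T =
  card-cong _ (pf-⊆ {S} {T} S≈T , pf-⊆ {T} {S} (≈ₛ-sym {S} {T} S≈T))

frobenius-resp : ∀ {F} → (λ S → HasFrobenius S F) Respects _≈ₛ_
frobenius-resp {_} {S} {T} S≈T (gap , bound) = to gap , bound ∘ from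
  where
  to   = proj₁ (gap-cong {S} {T} S≈T)
  from = proj₂ (gap-cong {S} {T} S≈T)

almostSymmetric-resp : AlmostSymmetric Respects _≈ₛ_
almostSymmetric-resp {S} {T} S≈T (g , F , t , genus , fr , ty , eq) =
  g , F , t , card-cong _ (gap-cong {S} {T} S≈T) genus
  , frobenius-resp {F} {S} {T} S≈T fr , type-resp {t} {S} {T} S≈T ty , eq

-- Enumeration of the semigroups with bounded gaps

sublists : ∀ {A : Set ℓ₀} → List A → List (List A)
sublists []       = [ [] ]
sublists (x ∷ xs) = sublists xs ++ map (x ∷_) (sublists xs)

filter∈sublists : ∀ {A : Set ℓ₀} {P : Pred A ℓ₁} (P? : Decidable P) xs →
                  filter P? xs ∈ₗ sublists xs
filter∈sublists P? []       = here refl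
filter∈sublists P? (x ∷ xs) with does (P? x)
... | false = Mem.∈-++⁺ˡ (filter∈sublists P? xs)
... | true  = Mem.∈-++⁺ʳ (sublists xs) (Mem.∈-map⁺ (x ∷_) (filter∈sublists P? xs))

-- The second condition is closure under addition read on complements: a sum that is a gap has a
-- summand that is a gap.
IsGapSet : List ℕ → Set
IsGapSet G = 0 ∉ₗ G × All (λ g → All (λ x → x ∈ₗ G ⊎ (g ∸ x) ∈ₗ G) (upTo (suc g))) G

isGapSet? : Decidable IsGapSet
isGapSet? G = ¬? (0 ∈ₗ? G) ×-dec
  All.all? (λ g → All.all? (λ x → x ∈ₗ? G ⊎-dec (g ∸ x) ∈ₗ? G) (upTo (suc g))) G

fromGaps : ∀ G → IsGapSet G → NumericalSemigroup
fromGaps G (0∉G , split) = record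
  { carrier  = _∉ₗ G
  ; decide   = λ x → ¬? (x ∈ₗ? G)
  ; 0∈       = 0∉G
  ; +-closed = λ {x} {y} x∉G y∉G x+y∈G →
      [ x∉G , y∉G ∘ subst (_∈ₗ G) (m+n∸m≡n x y) ]′
        (All.lookup (All.lookup split x+y∈G) (Mem.∈-upTo⁺ (s≤s (m≤m+n x y))))
  ; cofinite = finiteCardℕ (λ x → ¬? (¬? (x ∈ₗ? G))) G (decidable-stable (_ ∈ₗ? G))
  }

semigroupsOfGaps : List ℕ → List NumericalSemigroup
semigroupsOfGaps G with isGapSet? G
... | yes valid = [ fromGaps G valid ]
... | no  _     = []

semigroups : ℕ → List NumericalSemigroup
semigroups F = concatMap semigroupsOfGaps (sublists (upTo (suc F)))

open SetoidMembership semigroupSetoid using () renaming (_∈_ to _∈ₛ_)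

semigroups-cover : ∀ {F} S → HasFrobenius S F → S ∈ₛ semigroups F
semigroups-cover {F} S (_ , bound) =
  SetoidMem.∈-concatMap⁺ (setoid (List ℕ)) semigroupSetoid {y = S}
    (Any.map (λ { refl → S∈ }) (filter∈sublists gap? (upTo (suc F))))
  where
  open NumericalSemigroup S using (decide; 0∈; +-closed)

  gap? : Decidable (Gap S)
  gap? x = ¬? (decide x)

  G : List ℕ
  G = filter gap? (upTo (suc F))

  ∈G⁺ : ∀ {x} → x ∈ Gap S → x ∈ₗ G
  ∈G⁺ gap = Mem.∈-filter⁺ gap? (Mem.∈-upTo⁺ (s≤s (bound gap))) gap

  ∈G⁻ : ∀ {x} → x ∈ₗ G → x ∈ Gap S
  ∈G⁻ = proj₂ ∘ Mem.∈-filter⁻ gap? {xs = upTo (suc F)}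

  split : ∀ {g x} → g ∈ₗ G → x ≤ g → x ∈ₗ G ⊎ (g ∸ x) ∈ₗ G
  split {g} {x} g∈G x≤g with decide x | decide (g ∸ x)
  ... | no x∉S  | _         = inj₁ (∈G⁺ x∉S)
  ... | yes _   | no g∸x∉S  = inj₂ (∈G⁺ g∸x∉S)
  ... | yes x∈S | yes g∸x∈S = contradiction
    (subst (_∈ carrier S) (m+[n∸m]≡n x≤g) (+-closed x∈S g∸x∈S)) (∈G⁻ g∈G)

  isGapSet : IsGapSet G
  isGapSet = (λ 0∈G → ∈G⁻ 0∈G 0∈) , All.tabulate λ g∈G →
    All.tabulate λ x∈ → split g∈G (≤-pred (Mem.∈-upTo⁻ x∈))

  S∈ : S ∈ₛ semigroupsOfGaps G
  S∈ with isGapSet? G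
  ... | yes _      = here ( (λ x∈S x∈G → ∈G⁻ x∈G x∈S)
                          , (λ {x} x∉G → decidable-stable (decide x) (x∉G ∘ ∈G⁺)))
  ... | no ¬gapSet = contradiction isGapSet ¬gapSet

-- `T` is given by its graph, so a lower bound for it must come with a proof that the count exists.
T-finite : ∀ F t → ∃[ n ] T[ F , t ]≔ n
T-finite F t = finiteCard semigroupDecSetoid
  (λ S → frobenius? S F ×-dec type? S t)
  (λ {S} {T} S≈T (fr , ty) → frobenius-resp {F} {S} {T} S≈T fr , type-resp {t} {S} {T} S≈T ty)
  (semigroups F) (λ {S} (fr , _) → semigroups-cover S fr)

T₁-finite : ∀ F t → ∃[ n ] T₁[ F , t ]≔ n
T₁-finite F t = finiteCard semigroupDecSetoid
  (λ S → almostSymmetric-frobenius-type? S F t)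
  (λ {S} {T} S≈T (as , fr , ty) → almostSymmetric-resp {S} {T} S≈T as
    , frobenius-resp {F} {S} {T} S≈T fr , type-resp {t} {S} {T} S≈T ty)
  (semigroups F) (λ {S} (_ , fr , _) → semigroups-cover S fr)

-- The semigroup of a bit sequence

-- bits i says whether m + i ∈ Y, and the elements of rs are removed.  In the
-- last hypothesis p = F − r, and the element m ∈ Y witnesses that p is not
-- pseudo-Frobenius, since p + m is removed as well.
module Family
  (h b m : ℕ) (m≤1+h : m ≤ suc h) (F<3m : h + (suc h + b) < m + (m + m))
  (bits : ℕ → Bool) (rs : List ℕ) (rs! : Unique (setoid ℕ) rs)
  (r<2m  : ∀ {r} → r ∈ₗ rs → r < m + m)
  (F<m+r : ∀ {r} → r ∈ₗ rs → h + (suc h + b) < m + r)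
  (r<F   : ∀ {r} → r ∈ₗ rs → r < h + (suc h + b))
  (complement-not-PF : ∀ {r p} → r ∈ₗ rs → p + r ≡ h + (suc h + b) →
    m ≤ h × bits 0 ≡ true × p + m ∈ₗ rs)
  where

  u F : ℕ
  u = suc h + b
  F = h + u

  -- `Small` is `Y` together with 0. The bound `y < suc h` turns `Complemented` into a bounded
  -- search, and `y + z ≡ F` avoids truncated subtraction.
  Small Complemented Large Elem : ℕ → Set
  Small y        = y ≡ 0 ⊎ (m ≤ y × y ≤ h × bits (y ∸ m) ≡ true)
  Complemented z = ∃[ y ] (y < suc h × Small y × y + z ≡ F)
  Large z        = u ≤ z × z ∉ₗ rs × ¬ Complemented z
  Elem z         = Small z ⊎ Large z

  small? : ∀ y → Dec (Small y)
  small? y = y ≟ 0 ⊎-dec m ≤? y ×-dec y ≤? h ×-dec bits (y ∸ m) Bool.≟ true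

  complemented? : ∀ z → Dec (Complemented z)
  complemented? z = anyUpTo? (λ y → small? y ×-dec y + z ≟ F) (suc h)

  elem? : ∀ z → Dec (Elem z)
  elem? z = small? z ⊎-dec u ≤? z ×-dec ¬? (z ∈ₗ? rs) ×-dec ¬? (complemented? z)

  m≢0 : m ≢ 0
  m≢0 refl = n≮0 F<3m

  -- From `h + u < 3m ≤ (h + 1) + 2m`, cancelling `h`.
  u≤2m : u ≤ m + m
  u≤2m = +-cancelˡ-≤ h _ _ (≤-pred (<-≤-trans F<3m (+-monoˡ-≤ (m + m) m≤1+h)))

  m≤u : m ≤ u
  m≤u = ≤-trans m≤1+h (m≤m+n (suc h) b)

  u≤F : u ≤ F
  u≤F = m≤n+m u h

  u≤r : ∀ {r} → r ∈ₗ rs → u ≤ r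
  u≤r r∈rs = +-cancelˡ-≤ h _ _
    (≤-pred (<-≤-trans (F<m+r r∈rs) (+-monoˡ-≤ _ m≤1+h)))

  small≤h : ∀ {y} → Small y → y ≤ h
  small≤h (inj₁ refl)          = z≤n
  small≤h (inj₂ (_ , y≤h , _)) = y≤h

  ≤h⇒<u : ∀ {y} → y ≤ h → y < u
  ≤h⇒<u y≤h = ≤-trans (s≤s y≤h) (m≤m+n (suc h) b)

  u≤F∸ : ∀ {y} → y ≤ h → u ≤ F ∸ y
  u≤F∸ y≤h = ≤-trans (≤-reflexive (sym (m+n∸m≡n h u))) (∸-monoʳ-≤ F y≤h)

  ≤h⇒≤F : ∀ {y} → y ≤ h → y ≤ F
  ≤h⇒≤F y≤h = ≤-trans y≤h (m≤m+n h u)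

  middle∉ : ∀ {z} → h < z → z < u → ¬ Elem z
  middle∉ h<z z<u (inj₁ small)     = <⇒≱ h<z (small≤h small)
  middle∉ h<z z<u (inj₂ (u≤z , _)) = <⇒≱ z<u u≤z

  r∉ : ∀ {r} → r ∈ₗ rs → ¬ Elem r
  r∉ r∈rs (inj₁ small)            = <⇒≱ (≤h⇒<u (small≤h small)) (u≤r r∈rs)
  r∉ r∈rs (inj₂ (_ , r∉rs , _)) = r∉rs r∈rs

  nonzero⇒≥m : ∀ {z} → Elem z → z ≢ 0 → m ≤ z
  nonzero⇒≥m (inj₁ (inj₁ z≡0))       z≢0 = contradiction z≡0 z≢0
  nonzero⇒≥m (inj₁ (inj₂ (m≤z , _))) _   = m≤z
  nonzero⇒≥m (inj₂ (u≤z , _))        _   = ≤-trans m≤u u≤z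

  -- If `F − z` were in `Y`, it would be at least `m`, forcing `F ≥ 3m`; and every removed element
  -- is below `2m`.
  ≥2m⇒elem : ∀ {z} → m + m ≤ z → z ≢ F → Elem z
  ≥2m⇒elem {z} 2m≤z z≢F = inj₂
    ( ≤-trans u≤2m 2m≤z
    , (λ z∈rs → <⇒≱ (r<2m z∈rs) 2m≤z)
    , λ { (_ , _ , inj₁ refl , z≡F) → z≢F z≡F
        ; (y , _ , inj₂ (m≤y , _) , y+z≡F) →
            <⇒≱ F<3m (≤-trans (+-mono-≤ m≤y 2m≤z) (≤-reflexive y+z≡F)) })

  small+large≢F : ∀ {y z} → Small y → Large z → y + z ≢ F
  small+large≢F small (_ , _ , free) eq = free (_ , s≤s (small≤h small) , small , eq)

  h+h<F : h + h < F
  h+h<F = +-monoʳ-< h (m≤m+n (suc h) b)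

  -- Two small elements add up to at most `2h < F`, two large ones to at least `2u > F`, and the
  -- definition of `Large` excludes the mixed case.
  sum≢F : ∀ {x y} → Elem x → Elem y → x + y ≢ F
  sum≢F (inj₁ sx) (inj₁ sy) eq =
    <⇒≢ (≤-<-trans (+-mono-≤ (small≤h sx) (small≤h sy)) h+h<F) eq
  sum≢F (inj₁ sx) (inj₂ ly) eq = small+large≢F sx ly eq
  sum≢F {x} {y} (inj₂ lx) (inj₁ sy) eq = small+large≢F sy lx (trans (+-comm y x) eq)
  sum≢F (inj₂ (u≤x , _)) (inj₂ (u≤y , _)) eq =
    >⇒≢ (<-≤-trans (+-monoˡ-< u (≤h⇒<u ≤-refl)) (+-mono-≤ u≤x u≤y)) eq

  0-elem : Elem 0
  0-elem = inj₁ (inj₁ refl)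

  F∉ : ¬ Elem F
  F∉ e = sum≢F 0-elem e refl

  elem-+ : ∀ {x y} → Elem x → Elem y → Elem (x + y)
  elem-+ {x} {y} ex ey with x ≟ 0 | y ≟ 0
  ... | yes refl | _        = ey
  ... | no _     | yes refl = subst Elem (sym (+-identityʳ x)) ex
  ... | no x≢0   | no y≢0   =
    ≥2m⇒elem (+-mono-≤ (nonzero⇒≥m ex x≢0) (nonzero⇒≥m ey y≢0)) (sum≢F ex ey)

  gap≤F : ∀ {z} → ¬ Elem z → z ≤ F
  gap≤F {z} gap = ≮⇒≥ λ F<z → gap $ inj₂
    ( ≤-trans u≤F (<⇒≤ F<z)
    , (λ z∈rs → <-asym F<z (r<F z∈rs))
    , λ (y , _ , _ , y+z≡F) → <⇒≱ F<z (≤-trans (m≤n+m z y) (≤-reflexive y+z≡F)))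

  semigroup : NumericalSemigroup
  semigroup = record
    { carrier  = Elem
    ; decide   = elem?
    ; 0∈       = 0-elem
    ; +-closed = elem-+
    ; cofinite = finiteCardℕ (¬? ∘ elem?) (upTo (suc F)) (Mem.∈-upTo⁺ ∘ s≤s ∘ gap≤F)
    }

  -- This makes the bits readable from the semigroup: below `u` only `Small` can hold, and `m ≢ 0`
  -- separates `m + i` from the element 0.
  bit⇔elem : ∀ {i} → m + i ≤ h → bits i ≡ true ⇔ Elem (m + i)
  bit⇔elem {i} m+i≤h = mk⇔
    (λ bit → inj₁ (inj₂ (m≤m+n m i , m+i≤h , trans (cong bits (m+n∸m≡n m i)) bit)))
    λ { (inj₁ (inj₁ m+i≡0))         → contradiction (m+n≡0⇒m≡0 m m+i≡0) m≢0
      ; (inj₁ (inj₂ (_ , _ , bit))) → trans (cong bits (sym (m+n∸m≡n m i))) bit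
      ; (inj₂ (u≤m+i , _))          → contradiction u≤m+i (<⇒≱ (≤h⇒<u m+i≤h)) }

  hasFrobenius : HasFrobenius semigroup F
  hasFrobenius = F∉ , gap≤F

  -- Pseudo-Frobenius numbers and the type

  middle : List ℕ
  middle = applyUpTo (_+_ (suc h)) b

  ∈middle⁻ : ∀ {z} → z ∈ₗ middle → h < z × z < u
  ∈middle⁻ z∈ with Mem.∈-applyUpTo⁻ (_+_ (suc h)) z∈
  ... | i , i<b , refl = m≤m+n (suc h) i , +-monoʳ-< (suc h) i<b

  ∈middle⁺ : ∀ {z} → h < z → z < u → z ∈ₗ middle
  ∈middle⁺ {z} h<z z<u = subst (_∈ₗ middle) (m+[n∸m]≡n h<z)
    (Mem.∈-applyUpTo⁺ (_+_ (suc h))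
      (+-cancelˡ-< (suc h) _ _ (subst (_< u) (sym (m+[n∸m]≡n h<z)) z<u)))

  middle! : Unique (setoid ℕ) middle
  middle! = Uniqueₚ.applyUpTo⁺₁ (_+_ (suc h)) b
    (λ i<j _ eq → <⇒≢ i<j (+-cancelˡ-≡ (suc h) _ _ eq))

  removed⇒pf : ∀ {r} → r ∈ₗ rs → r ∈ PF semigroup
  removed⇒pf {r} r∈rs = r∉ r∈rs , λ {s} s∈ s≢0 → ≥2m⇒elem
    (+-mono-≤ (≤-trans m≤u (u≤r r∈rs)) (nonzero⇒≥m s∈ s≢0))
    λ r+s≡F → <⇒≱ (F<m+r r∈rs) (begin
      m + r  ≤⟨ +-monoˡ-≤ r (nonzero⇒≥m s∈ s≢0) ⟩
      s + r  ≡⟨ +-comm s r ⟩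
      r + s  ≡⟨ r+s≡F ⟩
      F      ∎)
    where open ≤-Reasoning

  -- As `F = h + u`, the reflection `z ↦ F − z` preserves the interval strictly between `h` and `u`,
  -- which contains no element; so `z + s` cannot be `F`.
  middle⇒pf : ∀ {z} → z ∈ₗ middle → z ∈ PF semigroup
  middle⇒pf {z} z∈ with h<z , z<u ← ∈middle⁻ z∈ =
    middle∉ h<z z<u , λ {s} s∈ s≢0 → ≥2m⇒elem
      (+-mono-≤ (≤-trans m≤1+h h<z) (nonzero⇒≥m s∈ s≢0))
      λ z+s≡F → middle∉
        (+-cancelˡ-< z _ _ (subst (z + h <_) (sym z+s≡F)
          (subst (_< F) (+-comm h z) (+-monoʳ-< h z<u))))
        (+-cancelˡ-< z _ _ (subst (_< z + u) (sym z+s≡F) (+-monoˡ-< u h<z)))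
        s∈

  F∈pf : F ∈ PF semigroup
  F∈pf = F∉ , λ {s} _ s≢0 → decidable-stable (elem? (F + s)) λ gap →
    <⇒≱ (m<m+n F (n≢0⇒n>0 s≢0)) (gap≤F gap)

  pfs : List ℕ
  pfs = F ∷ middle ++ rs

  pfs! : Unique (setoid ℕ) pfs
  pfs! = All.++⁺
      (All.tabulate (λ z∈ → >⇒≢ (<-≤-trans (proj₂ (∈middle⁻ z∈)) u≤F)))
      (All.tabulate (>⇒≢ ∘ r<F))
    ∷ Uniqueₚ.++⁺ middle! rs! λ (z∈ , z∈rs) → <⇒≱ (proj₂ (∈middle⁻ z∈)) (u≤r z∈rs)

  -- A gap `p ≥ u` that is neither `F` nor removed has `F − p` in `Y`, and adding it gives `F`. For
  -- a gap `p ≤ h`, the number `q = F − p` turns out to be an element, although `p + q = F` is not.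
  pf⇒∈pfs : ∀ {p} → p ∈ PF semigroup → p ∈ₗ pfs
  pf⇒∈pfs {p} (p∉ , closed) with p ≤? h | p <? u
  ... | no p≰h | yes p<u = there (Mem.∈-++⁺ˡ (∈middle⁺ (≰⇒> p≰h) p<u))
  ... | no p≰h | no p≮u with p ≟ F | p ∈ₗ? rs | complemented? p
  ...   | yes p≡F | _        | _     = here p≡F
  ...   | no _    | yes p∈rs | _     = there (Mem.∈-++⁺ʳ middle p∈rs)
  ...   | no _    | no p∉rs  | no ¬c = contradiction (inj₂ (≮⇒≥ p≮u , p∉rs , ¬c)) p∉
  ...   | no p≢F  | no _     | yes (y , _ , small , y+p≡F) = contradiction
    (subst Elem (trans (+-comm p y) y+p≡F)
      (closed (inj₁ small) λ { refl → p≢F y+p≡F })) F∉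
  pf⇒∈pfs {p} (p∉ , closed) | yes p≤h | _ = contradiction q-elem q∉
    where
    q : ℕ
    q = F ∸ p

    p+q≡F : p + q ≡ F
    p+q≡F = m+[n∸m]≡n (≤h⇒≤F p≤h)

    q≢0 : q ≢ 0
    q≢0 q≡0 = n≮0 (subst (u ≤_) q≡0 (u≤F∸ p≤h))

    q∉ : ¬ Elem q
    q∉ q-elem = F∉ (subst Elem p+q≡F (closed q-elem q≢0))

    q∉rs : q ∉ₗ rs
    -- If `q` was removed, so was `p + m`; but `bits 0` puts `m` into the semigroup, so `p + m`
    -- would have to be an element.
    q∉rs q∈rs with m≤h , bit , p+m∈rs ← complement-not-PF q∈rs p+q≡F =
      r∉ p+m∈rs (closed (inj₁ (inj₂ (≤-refl , m≤h , trans (cong bits (n∸n≡0 m)) bit))) m≢0)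

    q-elem : Elem q
    q-elem = inj₂ (u≤F∸ p≤h , q∉rs , λ (y , _ , small , y+q≡F) → p∉
      (inj₁ (subst Small (+-cancelʳ-≡ q y p (trans y+q≡F (sym p+q≡F))) small)))

  hasType : HasType semigroup (suc (b + length rs))
  hasType = record
    { elements = pfs
    ; unique   = pfs!
    ; sound    = F∈pf ∷ All.++⁺ (All.tabulate middle⇒pf) (All.tabulate removed⇒pf)
    ; complete = pf⇒∈pfs
    ; size     = cong suc (trans (length-++ middle)
                   (cong (_+ length rs) (length-applyUpTo (_+_ (suc h)) b)))
    }

  -- Genus and almost symmetry

  reflectSmall : ∀ {y} → Dec (Small y) → ℕ
  reflectSmall {y} (yes _) = F ∸ y
  reflectSmall {y} (no _)  = y

  -- For `y ≤ h` this picks a gap from the pair `y`, `F − y`. The decision is an argument of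
  -- `reflectSmall` so that `gapOf-cases` can split on it.
  gapOf : ℕ → ℕ
  gapOf y = reflectSmall (small? y)

  gapOf-cases : ∀ y → Small y × gapOf y ≡ F ∸ y ⊎ ¬ Small y × gapOf y ≡ y
  gapOf-cases y = cases (small? y)
    where
    cases : (d : Dec (Small y)) →
            Small y × reflectSmall d ≡ F ∸ y ⊎ ¬ Small y × reflectSmall d ≡ y
    cases (yes s) = inj₁ (s , refl)
    cases (no ¬s) = inj₂ (¬s , refl)

  gapOf-gap : ∀ {y} → y ≤ h → ¬ Elem (gapOf y)
  gapOf-gap {y} y≤h e with gapOf-cases y
  ... | inj₁ (s , eq) = sum≢F (inj₁ s) (subst Elem eq e) (m+[n∸m]≡n (≤h⇒≤F y≤h))
  ... | inj₂ (¬s , eq) with subst Elem eq e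
  ...   | inj₁ s         = ¬s s
  ...   | inj₂ (u≤y , _) = <⇒≱ (≤h⇒<u y≤h) u≤y

  gapOf-outside : ∀ {y} → y ≤ h → gapOf y ≤ h ⊎ u ≤ gapOf y
  gapOf-outside {y} y≤h with gapOf-cases y
  ... | inj₁ (_ , eq) = inj₂ (subst (u ≤_) (sym eq) (u≤F∸ y≤h))
  ... | inj₂ (_ , eq) = inj₁ (subst (_≤ h) (sym eq) y≤h)

  gapOf-injective : ∀ {x y} → x ≤ h → y ≤ h → gapOf x ≡ gapOf y → x ≡ y
  gapOf-injective {x} {y} x≤h y≤h eq with gapOf-cases x | gapOf-cases y
  ... | inj₁ (_ , p) | inj₁ (_ , q) =
    ∸-cancelˡ-≡ (≤h⇒≤F x≤h) (≤h⇒≤F y≤h) (trans (sym p) (trans eq q))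
  ... | inj₁ (_ , p) | inj₂ (_ , q) =
    contradiction (trans (sym p) (trans eq q)) (>⇒≢ (<-≤-trans (≤h⇒<u y≤h) (u≤F∸ x≤h)))
  ... | inj₂ (_ , p) | inj₁ (_ , q) =
    contradiction (trans (sym p) (trans eq q)) (<⇒≢ (<-≤-trans (≤h⇒<u x≤h) (u≤F∸ y≤h)))
  ... | inj₂ (_ , p) | inj₂ (_ , q) = trans (sym p) (trans eq q)

  gapList : List ℕ
  gapList = applyUpTo gapOf (suc h) ++ middle

  gap⇒∈gapList : (∀ {z} → z ∉ₗ rs) → ∀ {z} → ¬ Elem z → z ∈ₗ gapList
  gap⇒∈gapList rs-empty {z} z∉ with z ≤? h | z <? u
  ... | no z≰h | yes z<u = Mem.∈-++⁺ʳ _ (∈middle⁺ (≰⇒> z≰h) z<u)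
  ... | yes z≤h | _ with gapOf-cases z
  ...   | inj₁ (s , _)  = contradiction (inj₁ s) z∉
  ...   | inj₂ (_ , eq) = Mem.∈-++⁺ˡ
    (subst (_∈ₗ _) eq (Mem.∈-applyUpTo⁺ gapOf (s≤s z≤h)))
  gap⇒∈gapList rs-empty {z} z∉ | no _ | no z≮u with complemented? z
  ... | no ¬c = contradiction (inj₂ (≮⇒≥ z≮u , rs-empty , ¬c)) z∉
  ... | yes (y , y<1+h , s , y+z≡F) with gapOf-cases y
  ...   | inj₂ (¬s , _) = contradiction s ¬s
  ...   | inj₁ (_ , eq) = Mem.∈-++⁺ˡ
    (subst (_∈ₗ _) (trans eq (trans (cong (_∸ y) (sym y+z≡F)) (m+n∸m≡n y z)))
      (Mem.∈-applyUpTo⁺ gapOf y<1+h))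

  -- With nothing removed, each of the `h + 1` pairs contributes exactly one gap, and the `b` middle
  -- numbers are the remaining gaps.
  hasGenus : (∀ {z} → z ∉ₗ rs) → HasGenus semigroup (suc h + b)
  hasGenus rs-empty = record
    { elements = gapList
    ; unique   = Uniqueₚ.++⁺
        (Uniqueₚ.applyUpTo⁺₁ gapOf (suc h) λ i<j j<1+h eq → <⇒≢ i<j
          (gapOf-injective (≤-pred (<-trans i<j j<1+h)) (≤-pred j<1+h) eq))
        middle! λ (z∈ , z∈middle) → disjoint z∈ (∈middle⁻ z∈middle)
    ; sound    = All.++⁺
        (All.applyUpTo⁺₁ gapOf (suc h) (gapOf-gap ∘ ≤-pred))
        (All.tabulate (proj₁ ∘ middle⇒pf))
    ; complete = gap⇒∈gapList rs-empty
    ; size     = trans (length-++ (applyUpTo gapOf (suc h)))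
        (cong₂ _+_ (length-applyUpTo gapOf (suc h)) (length-applyUpTo (_+_ (suc h)) b))
    }
    where
    disjoint : ∀ {z} → z ∈ₗ applyUpTo gapOf (suc h) → ¬ (h < z × z < u)
    disjoint z∈ (h<z , z<u) with Mem.∈-applyUpTo⁻ gapOf z∈
    ... | y , y<1+h , refl with gapOf-outside (≤-pred y<1+h)
    ...   | inj₁ ≤h = <⇒≱ h<z ≤h
    ...   | inj₂ u≤ = <⇒≱ z<u u≤

  almostSymmetric : rs ≡ [] → AlmostSymmetric semigroup
  almostSymmetric refl =
    _ , _ , _ , hasGenus (λ ()) , hasFrobenius , hasType , eq h b
    where
    eq : ∀ h b → suc (b + 0) + (h + (suc h + b)) ≡ 2 * (suc h + b)
    eq = solve-∀

-- Counting semigroups that encode bit sequences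

infixr 5 _▹_

_▹_ : Bool → (ℕ → Bool) → ℕ → Bool
(b ▹ f) zero    = b
(b ▹ f) (suc i) = f i

-- Only the first `k` bits vary; `true` is an arbitrary filler beyond them.
bitSequences : ℕ → List (ℕ → Bool)
bitSequences zero    = [ (λ _ → true) ]
bitSequences (suc k) =
  map (true ▹_) (bitSequences k) ++ map (false ▹_) (bitSequences k)

length-bitSequences : ∀ k → length (bitSequences k) ≡ 2 ^ k
length-bitSequences zero    = refl
length-bitSequences (suc k) = begin
  length (map (true ▹_) fs ++ map (false ▹_) fs)
    ≡⟨ length-++ (map (true ▹_) fs) ⟩
  length (map (true ▹_) fs) + length (map (false ▹_) fs)
    ≡⟨ cong₂ _+_ (length-map _ fs) (length-map _ fs) ⟩
  length fs + length fs
    ≡⟨ cong₂ _+_ ih (trans ih (sym (+-identityʳ _))) ⟩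
  2 * 2 ^ k ∎
  where
  open ≡-Reasoning
  fs = bitSequences k
  ih = length-bitSequences k

-- An explicit position is recorded because it yields a number separating the two semigroups.
DifferBelow : ℕ → (ℕ → Bool) → (ℕ → Bool) → Set
DifferBelow k f g = ∃[ i ] (i < k × f i ≢ g i)

bitSequences-differ : ∀ k → AllPairs (DifferBelow k) (bitSequences k)
bitSequences-differ zero    = [] ∷ []
bitSequences-differ (suc k) = AllPairs.++⁺ (extend true) (extend false)
  (All.map⁺ (All.tabulate λ _ → All.map⁺ (All.tabulate λ _ → 0 , z<s , λ ())))
  where
  extend : ∀ b → AllPairs (DifferBelow (suc k)) (map (b ▹_) (bitSequences k))
  extend b = AllPairs.map⁺
    (AllPairs.map (λ (i , i<k , ≢) → suc i , s<s i<k , ≢) (bitSequences-differ k))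

Encodes : ℕ → ℕ → NumericalSemigroup → (ℕ → Bool) → Set
Encodes m k S f = ∀ {i} → i < k → f i ≡ true ⇔ m + i ∈ carrier S

-- Equal semigroups agree on each `m + i` and hence on each bit below `k`, so distinct sequences
-- give distinct semigroups.
2^k≤card : ∀ {P : Pred NumericalSemigroup 0ℓ} {n} m k (S : (ℕ → Bool) → NumericalSemigroup) →
           (∀ f → P (S f)) → (∀ f → Encodes m k (S f) f) →
           HasCard semigroupSetoid P n → 2 ^ k ≤ n
2^k≤card {P} {n} m k S PS encodes card = subst (_≤ n)
  (trans (length-map S (bitSequences k)) (length-bitSequences k))
  (card-≥ semigroupSetoid card
    (AllPairs.map⁺ (AllPairs.map differ⇒≉ (bitSequences-differ k)))
    (All.map⁺ (All.tabulate λ {f} _ → PS f)))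
  where
  differ⇒≉ : ∀ {f g} → DifferBelow k f g → ¬ (S f ≈ₛ S g)
  differ⇒≉ {f} {g} (i , i<k , fi≢gi) (⊆ , ⊇) = fi≢gi (Bool.⇔→≡ (mk⇔
    (Equivalence.from (encodes g i<k) ∘ ⊆ ∘ Equivalence.to (encodes f i<k))
    (Equivalence.from (encodes f i<k) ∘ ⊇ ∘ Equivalence.to (encodes g i<k))))

-- The two families, one for each parity

module Symmetric (h b m k : ℕ) (m+k≡1+h : m + k ≡ suc h)
                 (F<3m : h + (suc h + b) < m + (m + m)) where

  module Fam (f : ℕ → Bool) = Family h b m (m+n≤o⇒m≤o m (≤-reflexive m+k≡1+h)) F<3m f [] []
    (λ ()) (λ ()) (λ ()) (λ ())

  encodes : ∀ f → Encodes m k (Fam.semigroup f) f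
  encodes f {i} i<k =
    Fam.bit⇔elem f (≤-pred (subst (m + i <_) m+k≡1+h (+-monoʳ-< m i<k)))

  T₁≥ : ∀ {n} → T₁[ h + (suc h + b) , suc b ]≔ n → 2 ^ k ≤ n
  T₁≥ = 2^k≤card m k Fam.semigroup
    (λ f → Fam.almostSymmetric f refl , Fam.hasFrobenius f
      , subst (λ t → HasType (Fam.semigroup f) (suc t)) (+-identityʳ b) (Fam.hasType f))
    encodes

  T≥ : ∀ {n} → T[ h + (suc h + b) , suc b ]≔ n → 2 ^ k ≤ n
  T≥ = 2^k≤card m k Fam.semigroup
    (λ f → Fam.hasFrobenius f
      , subst (λ t → HasType (Fam.semigroup f) (suc t)) (+-identityʳ b) (Fam.hasType f))
    encodes

-- With `r = x + m = F − x`, the bound `x < m` gives `r < 2m` and `F = r + x < m + r`, while `0 < x`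
-- gives `r < F`.
module Punctured (h b m x k : ℕ) (m+k≡h : m + k ≡ h)
                 (F≡m+2x : h + (suc h + b) ≡ m + (x + x))
                 (0<x : 0 < x) (x<m : x < m) where

  private
    m≤h : m ≤ h
    m≤h = m+n≤o⇒m≤o m (≤-reflexive m+k≡h)

    F<3m : h + (suc h + b) < m + (m + m)
    F<3m = subst (_< m + (m + m)) (sym F≡m+2x) (+-monoʳ-< m (+-mono-< x<m x<m))

    r : ℕ
    r = x + m

    r+x≡F : r + x ≡ h + (suc h + b)
    r+x≡F = trans (eq x m) (sym F≡m+2x)
      where
      eq : ∀ x m → x + m + x ≡ m + (x + x)
      eq = solve-∀

    r<2m : ∀ {z} → z ∈ₗ [ r ] → z < m + m
    r<2m (here refl) = +-monoˡ-< m x<m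

    F<m+r : ∀ {z} → z ∈ₗ [ r ] → h + (suc h + b) < m + z
    F<m+r (here refl) = subst₂ _<_ r+x≡F (+-comm r m) (+-monoʳ-< r x<m)

    r<F : ∀ {z} → z ∈ₗ [ r ] → z < h + (suc h + b)
    r<F (here refl) = subst (r <_) r+x≡F (m<m+n r 0<x)

    x-not-PF : ∀ f {z p} → z ∈ₗ [ r ] → p + z ≡ h + (suc h + b) →
               m ≤ h × (true ▹ f) 0 ≡ true × p + m ∈ₗ [ r ]
    x-not-PF f {p = p} (here refl) p+r≡F = m≤h , refl , here (cong (_+ m)
      (+-cancelʳ-≡ r p x (trans p+r≡F (trans (sym r+x≡F) (+-comm r x)))))

  module Fam (f : ℕ → Bool) = Family h b m (m≤n⇒m≤1+n m≤h) F<3m (true ▹ f) [ r ] ([] ∷ [])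
    r<2m F<m+r r<F (x-not-PF f)

  T≥ : ∀ {n} → T[ h + (suc h + b) , suc (suc b) ]≔ n → 2 ^ k ≤ n
  -- The bit at `m` is fixed to `true`, so the free bits start at `m + 1` and there are `h − m` of
  -- them.
  T≥ = 2^k≤card (suc m) k Fam.semigroup
    (λ f → Fam.hasFrobenius f
      , subst (λ t → HasType (Fam.semigroup f) (suc t)) (+-comm b 1) (Fam.hasType f))
    λ f {i} i<k → subst (λ z → f i ≡ true ⇔ z ∈ carrier (Fam.semigroup f)) (+-suc m i)
      (Fam.bit⇔elem f (subst₂ _≤_ (sym (+-suc m i)) m+k≡h (+-monoʳ-< m i<k)))

-- Choice of the parameters

sameParity⇒∃h : ∀ {α F} → α ≤ F → F % 2 ≡ α % 2 → ∃[ h ] F ≡ h + h + α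
sameParity⇒∃h {α} {F} α≤F par = h , (begin
  F                         ≡⟨ m≡m%n+[m/n]*n F 2 ⟩
  F % 2 + F ℕ./ 2 * 2         ≡⟨ cong₂ (λ r q → r + q * 2) par (sym (m∸n+n≡m (/-monoˡ-≤ 2 α≤F))) ⟩
  α % 2 + (h + α ℕ./ 2) * 2   ≡⟨ eq (α % 2) h (α ℕ./ 2) ⟩
  h + h + (α % 2 + α ℕ./ 2 * 2) ≡⟨ cong (_+_ (h + h)) (sym (m≡m%n+[m/n]*n α 2)) ⟩
  h + h + α                 ∎)
  where
  open ≡-Reasoning
  h = F ℕ./ 2 ∸ α ℕ./ 2
  eq : ∀ r h q → r + (h + q) * 2 ≡ h + h + (r + q * 2)
  eq = solve-∀

∃h : ∀ {α F} → α ≤ F → (∃[ h ] F ≡ h + h + α) ⊎ (∃[ h ] F ≡ h + h + suc α)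
∃h {α} {F} α≤F = go (≤⇒≤′ α≤F)
  where
  go : ∀ {F} → α ≤′ F → (∃[ h ] F ≡ h + h + α) ⊎ (∃[ h ] F ≡ h + h + suc α)
  go ≤′-refl = inj₁ (0 , refl)
  go (≤′-step α≤F) with go α≤F
  ... | inj₁ (h , refl) = inj₂ (h , sym (+-suc (h + h) α))
  ... | inj₂ (h , refl) = inj₁ (suc h , eq h α)
    where
    eq : ∀ h α → suc (h + h + suc α) ≡ suc h + suc h + α
    eq = solve-∀

-- `F≤6k` is `k ≥ F/6 − α/2` cleared of denominators, with `α = b + 1`.
record SymmetricParameters (F b : ℕ) : Set where
  field
    h m k   : ℕ
    F≡      : F ≡ h + (suc h + b)
    m+k≡1+h : m + k ≡ suc h
    F<3m    : F < m + (m + m)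
    F≤6k    : F ≤ 6 * k + 3 * suc b

symmetricParameters : ∀ {F b} h → 3 * suc b < F → F ≡ h + h + suc b →
                      SymmetricParameters F b
symmetricParameters {F} {b} h 3α<F F≡2h+α = record
  { h       = h
  -- The least `m` with `F < 3m`, which leaves the most free bits.
  ; m       = suc q
  ; k       = k
  ; F≡      = trans F≡2h+α (eq₀ h b)
  ; m+k≡1+h = cong suc q+k≡h
  ; F<3m    = begin-strict
      F                     ≡⟨ m≡m%n+[m/n]*n F 3 ⟩
      F % 3 + q * 3         <⟨ +-monoˡ-< (q * 3) (m%n<n F 3) ⟩
      3 + q * 3             ≡⟨ eq₁ q ⟩
      suc q + (suc q + suc q) ∎
  -- Adding `2F` avoids division: `3F = 6h + 3α` and `6q ≤ 2F`.
  ; F≤6k    = +-cancelˡ-≤ (2 * F) _ _ (begin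
      2 * F + F                          ≡⟨ cong (λ F → 2 * F + F) F≡2h+α ⟩
      2 * (h + h + suc b) + (h + h + suc b) ≡⟨ eq₂ h b ⟩
      6 * h + 3 * suc b                  ≡⟨ cong (λ h → 6 * h + 3 * suc b) (sym q+k≡h) ⟩
      6 * (q + k) + 3 * suc b            ≡⟨ eq₃ q k b ⟩
      2 * (q * 3) + (6 * k + 3 * suc b)  ≤⟨ +-monoˡ-≤ _ (*-monoʳ-≤ 2 (m/n*n≤m F 3)) ⟩
      2 * F + (6 * k + 3 * suc b)        ∎)
  }
  where
  open ≤-Reasoning
  q = F ℕ./ 3
  k = h ∸ q

  eq₀ : ∀ h b → h + h + suc b ≡ h + (suc h + b)
  eq₀ = solve-∀
  eq₁ : ∀ q → 3 + q * 3 ≡ suc q + (suc q + suc q)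
  eq₁ = solve-∀
  eq₂ : ∀ h b → 2 * (h + h + suc b) + (h + h + suc b) ≡ 6 * h + 3 * suc b
  eq₂ = solve-∀
  eq₃ : ∀ q k b → 6 * (q + k) + 3 * suc b ≡ 2 * (q * 3) + (6 * k + 3 * suc b)
  eq₃ = solve-∀
  eq₄ : ∀ h b → 6 * h + 3 * suc b ≡ 2 * (h * 3) + 3 * suc b
  eq₄ = solve-∀

  q≤h : q ≤ h
  q≤h = ≮⇒≥ λ h<q → <⇒≱ 3α<F (+-cancelˡ-≤ (2 * F) _ _ (begin
    2 * F + F                             ≡⟨ cong (λ F → 2 * F + F) F≡2h+α ⟩
    2 * (h + h + suc b) + (h + h + suc b) ≡⟨ eq₂ h b ⟩
    6 * h + 3 * suc b                     ≡⟨ eq₄ h b ⟩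
    2 * (h * 3) + 3 * suc b               ≤⟨ +-monoˡ-≤ _ (*-monoʳ-≤ 2 (*-monoˡ-≤ 3 (<⇒≤ h<q))) ⟩
    2 * (q * 3) + 3 * suc b               ≤⟨ +-monoˡ-≤ _ (*-monoʳ-≤ 2 (m/n*n≤m F 3)) ⟩
    2 * F + 3 * suc b                     ∎))

  q+k≡h : q + k ≡ h
  q+k≡h = m+[n∸m]≡n q≤h

record PuncturedParameters (F b : ℕ) : Set where
  field
    h m x k : ℕ
    F≡2h   : F ≡ h + (suc h + b)
    F≡m+2x : F ≡ m + (x + x)
    m+k≡h  : m + k ≡ h
    0<x    : 0 < x
    x<m    : x < m
    F≤6k   : F ≤ 6 * k + (3 * b + 21)

-- `x = ⌊(F − 1)/3⌋` is the largest `x` with `3x < F`, so `x < m = F − 2x ≤ x + 3`. The 21 is 3 from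
-- `3(b + 1)` plus `6 · 3` from `m ≤ x + 3`.
puncturedParameters : ∀ {F b} h → 3 * b + 21 < F → F ≡ h + h + suc b →
                      PuncturedParameters F b
puncturedParameters {suc F′} {b} h big F≡2h+α = record
  { h      = h
  ; m      = m
  ; x      = x
  ; k      = k
  ; F≡2h   = trans F≡2h+α (eq₀ h b)
  ; F≡m+2x = sym m+2x≡F
  ; m+k≡h  = m+k≡h
  ; 0<x    = n≢0⇒n>0 λ x≡0 → <⇒≱ big (begin
      F                  ≤⟨ F≤3+3x ⟩
      3 + x * 3          ≡⟨ cong (λ x → 3 + x * 3) x≡0 ⟩
      3                  ≤⟨ m≤m+n 3 18 ⟩
      21                 ≤⟨ m≤n+m 21 (3 * b) ⟩
      3 * b + 21         ∎)
  ; x<m    = +-cancelʳ-< (x + x) x m (begin-strict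
      x + (x + x)        ≡⟨ eq₁ x ⟩
      x * 3              <⟨ s≤s (m/n*n≤m F′ 3) ⟩
      F                  ≡⟨ m+2x≡F ⟨
      m + (x + x)        ∎)
  ; F≤6k   = +-cancelˡ-≤ (2 * F) _ _ (begin
      2 * F + F                             ≡⟨ cong (λ F → 2 * F + F) F≡2h+α ⟩
      2 * (h + h + suc b) + (h + h + suc b) ≡⟨ eq₂ h b ⟩
      6 * h + (3 * b + 3)                   ≡⟨ cong (λ h → 6 * h + (3 * b + 3)) (sym m+k≡h) ⟩
      6 * (m + k) + (3 * b + 3)             ≡⟨ eq₃ m k b ⟩
      6 * m + (6 * k + (3 * b + 3))         ≤⟨ +-monoˡ-≤ _ (*-monoʳ-≤ 6 m≤3+x) ⟩
      6 * (3 + x) + (6 * k + (3 * b + 3))   ≡⟨ eq₄ x k b ⟩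
      2 * (x * 3) + (6 * k + (3 * b + 21))  ≤⟨ +-monoˡ-≤ _ (*-monoʳ-≤ 2 x*3≤F) ⟩
      2 * F + (6 * k + (3 * b + 21))        ∎)
  }
  where
  open ≤-Reasoning
  F = suc F′
  x = F′ ℕ./ 3
  m = F ∸ (x + x)
  k = h ∸ m

  eq₀ : ∀ h b → h + h + suc b ≡ h + (suc h + b)
  eq₀ = solve-∀
  eq₁ : ∀ x → x + (x + x) ≡ x * 3
  eq₁ = solve-∀
  eq₂ : ∀ h b → 2 * (h + h + suc b) + (h + h + suc b) ≡ 6 * h + (3 * b + 3)
  eq₂ = solve-∀
  eq₃ : ∀ m k b → 6 * (m + k) + (3 * b + 3) ≡ 6 * m + (6 * k + (3 * b + 3))
  eq₃ = solve-∀
  eq₄ : ∀ x k b → 6 * (3 + x) + (6 * k + (3 * b + 3)) ≡ 2 * (x * 3) + (6 * k + (3 * b + 21))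
  eq₄ = solve-∀
  eq₅ : ∀ x b → 6 * (3 + x) + (3 * b + 3) ≡ 2 * (x * 3) + (3 * b + 21)
  eq₅ = solve-∀
  eq₆ : ∀ x → 3 + x * 3 ≡ (3 + x) + (x + x)
  eq₆ = solve-∀

  x*3≤F : x * 3 ≤ F
  x*3≤F = m≤n⇒m≤1+n (m/n*n≤m F′ 3)

  m+2x≡F : m + (x + x) ≡ F
  m+2x≡F = m∸n+n≡m (≤-trans (m≤n+m (x + x) x) (≤-trans (≤-reflexive (eq₁ x)) x*3≤F))

  F≤3+3x : F ≤ 3 + x * 3
  F≤3+3x = begin
    suc F′                   ≡⟨ cong suc (m≡m%n+[m/n]*n F′ 3) ⟩
    suc (F′ % 3) + x * 3     ≤⟨ +-monoˡ-≤ (x * 3) (m%n<n F′ 3) ⟩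
    3 + x * 3                ∎

  m≤3+x : m ≤ 3 + x
  m≤3+x = +-cancelʳ-≤ (x + x) m (3 + x) (begin
    m + (x + x)         ≡⟨ m+2x≡F ⟩
    F                   ≤⟨ F≤3+3x ⟩
    3 + x * 3           ≡⟨ eq₆ x ⟩
    (3 + x) + (x + x)   ∎)

  m≤h : m ≤ h
  m≤h = ≮⇒≥ λ h<m → <⇒≱ big (+-cancelˡ-≤ (2 * F) _ _ (begin
    2 * F + F                             ≡⟨ cong (λ F → 2 * F + F) F≡2h+α ⟩
    2 * (h + h + suc b) + (h + h + suc b) ≡⟨ eq₂ h b ⟩
    6 * h + (3 * b + 3)                   ≤⟨ +-monoˡ-≤ _ (*-monoʳ-≤ 6 (≤-trans (<⇒≤ h<m) m≤3+x)) ⟩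
    6 * (3 + x) + (3 * b + 3)             ≡⟨ eq₅ x b ⟩
    2 * (x * 3) + (3 * b + 21)            ≤⟨ +-monoˡ-≤ _ (*-monoʳ-≤ 2 x*3≤F) ⟩
    2 * F + (3 * b + 21)                  ∎))

  m+k≡h : m + k ≡ h
  m+k≡h = m+[n∸m]≡n m≤h

symmetric-T₁≥ : ∀ {F b n} → SymmetricParameters F b → T₁[ F , suc b ]≔ n →
                ∃[ k ] (2 ^ k ≤ n × F ≤ 6 * k + 3 * suc b)
symmetric-T₁≥ {b = b} record { h = h ; m = m ; k = k ; F≡ = refl ; m+k≡1+h = m+k≡1+h
                             ; F<3m = F<3m ; F≤6k = F≤6k } card =
  k , Symmetric.T₁≥ h b m k m+k≡1+h F<3m card , F≤6k

symmetric-T≥ : ∀ {F b n} → SymmetricParameters F b → T[ F , suc b ]≔ n →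
               ∃[ k ] (2 ^ k ≤ n × F ≤ 6 * k + 3 * suc b)
symmetric-T≥ {b = b} record { h = h ; m = m ; k = k ; F≡ = refl ; m+k≡1+h = m+k≡1+h
                            ; F<3m = F<3m ; F≤6k = F≤6k } card =
  k , Symmetric.T≥ h b m k m+k≡1+h F<3m card , F≤6k

punctured-T≥ : ∀ {F b n} → PuncturedParameters F b → T[ F , suc (suc b) ]≔ n →
               ∃[ k ] (2 ^ k ≤ n × F ≤ 6 * k + (3 * b + 21))
punctured-T≥ {b = b} record { h = h ; m = m ; x = x ; k = k ; F≡2h = refl ; F≡m+2x = F≡m+2x
                            ; m+k≡h = m+k≡h ; 0<x = 0<x ; x<m = x<m ; F≤6k = F≤6k } card =
  k , Punctured.T≥ h b m x k m+k≡h F≡m+2x 0<x x<m card , F≤6k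

T₁-lowerBound : ∀ {F b n} → 3 * suc b < F → F % 2 ≡ suc b % 2 → T₁[ F , suc b ]≔ n →
                ∃[ k ] (2 ^ k ≤ n × F ≤ 6 * k + 3 * suc b)
T₁-lowerBound {F} {b} 3α<F par =
  let h , F≡2h+α = sameParity⇒∃h (≤-trans (m≤m+n (suc b) _) (<⇒≤ 3α<F)) par
  in symmetric-T₁≥ (symmetricParameters h 3α<F F≡2h+α)

1+b≤3b+21 : ∀ b → suc b ≤ 3 * b + 21
1+b≤3b+21 b = ≤-trans (m≤m+n (suc b) (b + b + 20)) (≤-reflexive (eq b))
  where
  eq : ∀ b → suc b + (b + b + 20) ≡ 3 * b + 21
  eq = solve-∀

3α≤3b+21 : ∀ b → 3 * suc (suc b) ≤ 3 * b + 21
3α≤3b+21 b = ≤-trans (m≤m+n (3 * suc (suc b)) 15) (≤-reflexive (eq b))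
  where
  eq : ∀ b → 3 * suc (suc b) + 15 ≡ 3 * b + 21
  eq = solve-∀

weaken : ∀ {F C D n} → C ≤ D → ∃[ k ] (2 ^ k ≤ n × F ≤ 6 * k + C) →
         ∃[ k ] (2 ^ k ≤ n × F ≤ 6 * k + D)
weaken C≤D (k , 2^k≤n , F≤) = k , 2^k≤n , ≤-trans F≤ (+-monoʳ-≤ (6 * k) C≤D)

T-lowerBound : ∀ {F b n} → 3 * b + 21 < F → T[ F , suc (suc b) ]≔ n →
               ∃[ k ] (2 ^ k ≤ n × F ≤ 6 * k + (3 * b + 21))
T-lowerBound {F} {b} {n} big card =
  -- If `F − (b + 1)` is even, type `b + 2` has the wrong parity for the symmetric family and needs
  -- the punctured one; otherwise the symmetric family applies with `b + 1` for `b`.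
  [ (λ (h , F≡2h+1+b) → punctured-T≥ (puncturedParameters h big F≡2h+1+b) card)
  , (λ (h , F≡2h+α) → weaken (3α≤3b+21 b)
      (symmetric-T≥ (symmetricParameters h (≤-<-trans (3α≤3b+21 b) big) F≡2h+α) card))
  ]′ (∃h 1+b≤F)
  where
  1+b≤F : suc b ≤ F
  1+b≤F = ≤-trans (1+b≤3b+21 b) (<⇒≤ big)

-- The two bounds as exponents

2^≤^ : ∀ {a n} k d → a ≤ k * d → 2 ^ k ≤ n → 2 ^ a ≤ n ^ d
2^≤^ {a} {n} k d a≤kd 2^k≤n = begin
  2 ^ a          ≤⟨ ^-monoʳ-≤ 2 a≤kd ⟩
  2 ^ (k * d)    ≡⟨ ^-*-assoc 2 k d ⟨
  (2 ^ k) ^ d    ≤⟨ ^-monoˡ-≤ d 2^k≤n ⟩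
  n ^ d          ∎
  where open ≤-Reasoning

-- ℚᵘ does not reduce fractions: F/6 − α/2 is (2F − 6α)/12, here with F = c + 3α.
numerator : ∀ c α → + (c + 3 * α) ℤ.* + 2 ℤ.+ (ℤ.- (+ α)) ℤ.* + 6 ≡ + (2 * c)
numerator c α = begin
  + (c + 3 * α) ℤ.* + 2 ℤ.+ (ℤ.- (+ α)) ℤ.* + 6
    ≡⟨ cong (λ i → i ℤ.* + 2 ℤ.+ (ℤ.- (+ α)) ℤ.* + 6)
         (trans (ℤ.pos-+ c (3 * α)) (cong (ℤ._+_ (+ c)) (ℤ.pos-* 3 α))) ⟩
  (+ c ℤ.+ + 3 ℤ.* + α) ℤ.* + 2 ℤ.+ (ℤ.- (+ α)) ℤ.* + 6
    ≡⟨ eq (+ c) (+ α) ⟩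
  + 2 ℤ.* + c
    ≡⟨ ℤ.pos-* 2 c ⟨
  + (2 * c) ∎
  where
  open ≡-Reasoning
  eq : ∀ c α → (c ℤ.+ + 3 ℤ.* α) ℤ.* + 2 ℤ.+ (ℤ.- α) ℤ.* + 6 ≡ + 2 ℤ.* c
  eq = ℤSolver.solve-∀

F/6-α/2≤ : ∀ {F n} α k → 3 * α ≤ F → F ≤ 6 * k + 3 * α → 2 ^ k ≤ n →
           2^ℚ ((+ F / 6) ℚ.- (+ α / 2)) ≤ n
F/6-α/2≤ {F} {n} α k 3α≤F F≤6k+3α 2^k≤n =
  -- Writing the numerator as `2c` selects the nonnegative clause of `2^ℚ_≤_`. The stored 11 means
  -- denominator 12, and `c ≤ 6k` gives `2c ≤ 12k`.
  subst (λ i → 2^ℚ mkℚᵘ i 11 ≤ n)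
    (trans (sym (numerator c α)) (cong (λ F → + F ℤ.* + 2 ℤ.+ (ℤ.- (+ α)) ℤ.* + 6) c+3α≡F)) (2^≤^ k 12 a≤k*12 2^k≤n)
  where
  open ≤-Reasoning
  c = F ∸ 3 * α
  a = 2 * c

  c+3α≡F : c + 3 * α ≡ F
  c+3α≡F = m∸n+n≡m 3α≤F

  a≤k*12 : a ≤ k * 12
  a≤k*12 = begin
    2 * c        ≤⟨ *-monoʳ-≤ 2 (+-cancelʳ-≤ (3 * α) c (6 * k)
                       (subst (_≤ 6 * k + 3 * α) (sym c+3α≡F) F≤6k+3α)) ⟩
    2 * (6 * k)  ≡⟨ eq k ⟩
    k * 12       ∎
    where
    eq : ∀ k → 2 * (6 * k) ≡ k * 12
    eq = solve-∀

/1-+ : ∀ a b → + (a + b) / 1 ℚ.≃ (+ a / 1) ℚ.+ (+ b / 1)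
/1-+ a b = ℚ.*≡* (trans (cong (ℤ._* (+ 1 ℤ.* + 1)) (ℤ.pos-+ a b)) (eq (+ a) (+ b)))
  where
  eq : ∀ a b → (a ℤ.+ b) ℤ.* (+ 1 ℤ.* + 1) ≡ (a ℤ.* + 1 ℤ.+ b ℤ.* + 1) ℤ.* + 1
  eq = ℤSolver.solve-∀

-- This is `y ≤ t − δ` multiplied by `F`, by induction because `_·ᴿ_` is iterated addition.
·ᴿ-bound : ∀ y {δ t} n → seq y n ℚ.+ δ ℚ.≤ t → ∀ F →
           seq (F ·ᴿ y) n ℚ.+ (+ F / 1) ℚ.* δ ℚ.≤ (+ F / 1) ℚ.* t
·ᴿ-bound y {δ} {t} n y+δ≤t zero = ℚ.≤-reflexive (begin-equality
  0ℚᵘ ℚ.+ 0ℚᵘ ℚ.* δ  ≃⟨ ℚ.+-identityˡ (0ℚᵘ ℚ.* δ) ⟩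
  0ℚᵘ ℚ.* δ          ≃⟨ ℚ.*-zeroˡ δ ⟩
  0ℚᵘ                ≃⟨ ℚ.*-zeroˡ t ⟨
  0ℚᵘ ℚ.* t          ∎)
  where open ℚ.≤-Reasoning
·ᴿ-bound y {δ} {t} n y+δ≤t (suc F) = begin
  (s ℚ.+ S) ℚ.+ (+ suc F / 1) ℚ.* δ
    ≃⟨ ℚ.+-congʳ (s ℚ.+ S) (ℚ.*-congʳ {δ} (/1-+ 1 F)) ⟩
  (s ℚ.+ S) ℚ.+ (1ℚᵘ ℚ.+ f) ℚ.* δ
    ≃⟨ solve 4 (λ s S f δ → (s :+ S) :+ (con 1ℚᵘ :+ f) :* δ := (s :+ δ) :+ (S :+ f :* δ))
         ℚ.≃-refl s S f δ ⟩
  (s ℚ.+ δ) ℚ.+ (S ℚ.+ f ℚ.* δ)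
    ≤⟨ ℚ.+-mono-≤ y+δ≤t (·ᴿ-bound y n y+δ≤t F) ⟩
  t ℚ.+ f ℚ.* t
    ≃⟨ solve 2 (λ f t → t :+ f :* t := (con 1ℚᵘ :+ f) :* t) ℚ.≃-refl f t ⟩
  (1ℚᵘ ℚ.+ f) ℚ.* t
    ≃⟨ ℚ.*-congʳ {t} (/1-+ 1 F) ⟨
  (+ suc F / 1) ℚ.* t ∎
  where
  open ℚ.≤-Reasoning
  open +-*-Solver using (solve; _:+_; _:*_; _:=_; con)
  s = seq y n
  S = seq (F ·ᴿ y) n
  f = + F / 1

-- The gain F ε eventually exceeds the additive constant C.
F[1/10-ε]< : ∀ (ε : ℝ) → 0ᴿ <ᴿ ε → ∀ C → ∃[ F₁ ] (∀ F k n → F₁ ≤ F →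
             F ≤ 10 * (k + C) → 2 ^ k ≤ n →
             2^ℝ (F ·ᴿ (fromℚ (+ 1 / 10) -ᴿ ε)) < n)
F[1/10-ε]< ε (mkℚᵘ -[1+ _ ] _ , ℚ.*<* () , _) C
F[1/10-ε]< ε (mkℚᵘ (+ zero) _ , ℚ.*<* (ℤ.+<+ ()) , _) C
-- Since `δ ≥ 1/(q + 1)`, this threshold gives `Fδ ≥ C + 1`.
F[1/10-ε]< ε (δ@(mkℚᵘ (+ suc p) q) , 0<δ , N , δ≤ε) C = suc C * suc q , λ F k n F₁≤F F≤10 2^k≤n →
  -- The rational exponent is `k`. Of the gain `C + 1`, the part `C` pays for `F/10 ≤ k + C` and 1
  -- remains as the strict margin.
  + k / 1 , (1ℚᵘ , ℚ.positive⁻¹ 1ℚᵘ , N , λ {i} N≤i → upper F k F₁≤F F≤10 i N≤i)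
  , subst (2 ^ k ≤_) (sym (*-identityʳ n)) 2^k≤n
  where
  open ℚ.≤-Reasoning
  open +-*-Solver using (solve; _:+_; _:*_; :-_; _:=_; con)
  t = + 1 / 10
  y = fromℚ t -ᴿ ε

  y+δ≤t : ∀ i → N ≤ i → seq y i ℚ.+ δ ℚ.≤ t
  y+δ≤t i N≤i = begin
    (t ℚ.- e) ℚ.+ δ            ≃⟨ ℚ.+-congʳ (t ℚ.- e) (ℚ.+-identityˡ δ) ⟨
    (t ℚ.- e) ℚ.+ (0ℚᵘ ℚ.+ δ)  ≤⟨ ℚ.+-monoʳ-≤ (t ℚ.- e) (δ≤ε N≤i) ⟩
    (t ℚ.- e) ℚ.+ e            ≃⟨ solve 2 (λ t e → (t :+ (:- e)) :+ e := t) ℚ.≃-refl t e ⟩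
    t                          ∎
    where e = seq ε i

  1+C≤Fδ : ∀ {F} → suc C * suc q ≤ F → + suc C / 1 ℚ.≤ (+ F / 1) ℚ.* δ
  1+C≤Fδ {F} F₁≤F = ℚ.*≤* (subst₂ ℤ._≤_ (ℤ.pos-* (suc C) (1 * suc q))
    (trans (ℤ.pos-* (F * suc p) 1) (cong (ℤ._* + 1) (ℤ.pos-* F (suc p))))
    (ℤ.+≤+ (subst₂ _≤_ (cong (suc C *_) (sym (*-identityˡ (suc q)))) (sym (*-identityʳ (F * suc p)))
      (≤-trans F₁≤F (m≤m*n F (suc p))))))

  F/10≤ : ∀ {F k} → F ≤ 10 * (k + C) → (+ F / 1) ℚ.* t ℚ.≤ + (k + C) / 1
  F/10≤ {F} {k} F≤10 = ℚ.*≤* (subst₂ ℤ._≤_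
    (trans (sym (ℤ.*-identityʳ (+ F))) (sym (ℤ.*-identityʳ (+ F ℤ.* + 1))))
    (ℤ.pos-* (k + C) 10)
    (ℤ.+≤+ (subst (F ≤_) (*-comm 10 (k + C)) F≤10)))

  upper : ∀ F k → suc C * suc q ≤ F → F ≤ 10 * (k + C) → ∀ i → N ≤ i →
          seq (F ·ᴿ y) i ℚ.+ 1ℚᵘ ℚ.≤ + k / 1
  upper F k F₁≤F F≤10 i N≤i = begin
    S ℚ.+ 1ℚᵘ
      ≃⟨ solve 2 (λ S c → S :+ con 1ℚᵘ := (S :+ (con 1ℚᵘ :+ c)) :+ (:- c)) ℚ.≃-refl S c ⟩
    (S ℚ.+ (1ℚᵘ ℚ.+ c)) ℚ.- c
      ≃⟨ ℚ.+-congˡ (ℚ.- c) (ℚ.+-congʳ S (/1-+ 1 C)) ⟨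
    (S ℚ.+ (+ suc C / 1)) ℚ.- c
      ≤⟨ ℚ.+-monoˡ-≤ (ℚ.- c) (ℚ.+-monoʳ-≤ S (1+C≤Fδ F₁≤F)) ⟩
    (S ℚ.+ (+ F / 1) ℚ.* δ) ℚ.- c
      ≤⟨ ℚ.+-monoˡ-≤ (ℚ.- c) (·ᴿ-bound y i (y+δ≤t i N≤i) F) ⟩
    (+ F / 1) ℚ.* t ℚ.- c
      ≤⟨ ℚ.+-monoˡ-≤ (ℚ.- c) (F/10≤ {F} {k} F≤10) ⟩
    (+ (k + C) / 1) ℚ.- c
      ≃⟨ ℚ.+-congˡ (ℚ.- c) (/1-+ k C) ⟩
    ((+ k / 1) ℚ.+ c) ℚ.- c
      ≃⟨ solve 2 (λ k c → (k :+ c) :+ (:- c) := k) ℚ.≃-refl (+ k / 1) c ⟩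
    + k / 1 ∎
    where
    S = seq (F ·ᴿ y) i
    c = + C / 1

theorem1p8 : (∀ α F → 1 ≤ α → 3 * α + 3 < F → F % 2 ≡ α % 2 →
    ∃[ n ] (T₁[ F , α ]≔ n × 2^ℚ ((+ F / 6) - (+ α / 2)) ≤ n))
    ×
    (∀ α → 2 ≤ α → ∀ (ε : ℝ) → 0ᴿ <ᴿ ε →
    ∃[ F₀ ] (∀ F → F₀ ≤ F →
    ∃[ n ] (T[ F , α ]≔ n × 2^ℝ (F ·ᴿ (fromℚ (+ 1 / 10) -ᴿ ε)) < n)))
theorem1p8 = part₁ , part₂
  where
  part₁ : ∀ α F → 1 ≤ α → 3 * α + 3 < F → F % 2 ≡ α % 2 →
          ∃[ n ] (T₁[ F , α ]≔ n × 2^ℚ ((+ F / 6) - (+ α / 2)) ≤ n)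
  part₁ α@(suc b) F _ 3α+3<F par =
    let n , card            = T₁-finite F α
        3α<F                = ≤-<-trans (m≤m+n (3 * α) 3) 3α+3<F
        k , 2^k≤n , F≤6k+3α = T₁-lowerBound 3α<F par card
    in n , card , F/6-α/2≤ α k (<⇒≤ 3α<F) F≤6k+3α 2^k≤n

  part₂ : ∀ α → 2 ≤ α → ∀ (ε : ℝ) → 0ᴿ <ᴿ ε →
          ∃[ F₀ ] (∀ F → F₀ ≤ F →
          ∃[ n ] (T[ F , α ]≔ n × 2^ℝ (F ·ᴿ (fromℚ (+ 1 / 10) -ᴿ ε)) < n))
  part₂ (suc zero) (s≤s ())
  part₂ α@(suc (suc b)) _ ε 0<ε =
    let C         = 3 * b + 21
        F₁ , below = F[1/10-ε]< ε 0<ε C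
    -- `T-lowerBound` needs `C < F`, and absorbing the constant needs `F₁ ≤ F`.
    in F₁ ⊔ suc C , λ F F₀≤F →
      let n , card            = T-finite F α
          k , 2^k≤n , F≤6k+C  = T-lowerBound (m⊔n≤o⇒n≤o F₁ (suc C) F₀≤F) card
      in n , card , below F k n (m⊔n≤o⇒m≤o F₁ (suc C) F₀≤F) (≤-trans F≤6k+C (6k+C≤ k C)) 2^k≤n
    where
    -- Here the rate 1/6 of the construction is relaxed to 1/10.
    6k+C≤ : ∀ k C → 6 * k + C ≤ 10 * (k + C)
    6k+C≤ k C = ≤-trans (+-mono-≤ (*-monoˡ-≤ k (m≤m+n 6 4)) (m≤m+n C (9 * C)))
      (≤-reflexive (sym (*-distribˡ-+ 10 k C)))
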